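{- Let $p>3$ be a prime and $n>2$ an integer, and suppose that $R=p2^n+1$ is composite and satisfies $$3^{\frac{R-1}{2}}\equiv -1 \pmod R.$$ Then every factor $f>1$ of $R$ is of the form $f=k2^n+1$ for some positive integer $k$, and moreover $f$ is primover to base $3$ and $O_f(3)=2^n$.
   Context: For an integer $d>1$ coprime to $3$, $O_d(3)$ denotes the multiplicative order of $3$ modulo $d$. A composite integer $N$ coprime to $3$ is called an overpseudoprime to base $3$ if $O_d(3)=O_N(3)$ for every divisor $d>1$ of $N$. An integer $N>1$ coprime to $3$ is called primover to base $3$ if it is either prime or an overpseudoprime to base $3$. -}

module Defs where

open import Data.Integer.Base using (ℤ; +_; 1ℤ) renaming (_-_ to _-ℤ_)
import Data.Integer.Divisibility as ℤ
open import Data.Nat.Base using (ℕ; _^_; _≤_; _<_)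
open import Data.Nat.Coprimality using (Coprime)
open import Data.Nat.Divisibility using (_∣_)
open import Data.Nat.Primality using (Prime; Composite)
open import Data.Nat.Properties using (≤-antisym)
open import Data.Product.Base using (_×_; _,_; ∃-syntax)
open import Data.Sum.Base using (_⊎_)
open import Relation.Binary.PropositionalEquality using (_≡_)

infix 4 _≡_[mod_]

_≡_[mod_] : ℤ → ℤ → ℕ → Set
a ≡ b [mod m ] = + m ℤ.∣ (a -ℤ b)

-- IsOrder b d k says that O_d(b) is defined and equals k.  The partial function
-- d ↦ O_d(b) is represented by its graph: for d > 1 some k exists exactly when
-- d is coprime to b, and IsOrder-unique shows that k is determined.
IsOrder : ℕ → ℕ → ℕ → Set
IsOrder b d k =
  0 < k ×
  (+ (b ^ k) ≡ 1ℤ [mod d ]) ×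
  (∀ j → 0 < j → + (b ^ j) ≡ 1ℤ [mod d ] → k ≤ j)

IsOrder-unique : ∀ {b d k l} → IsOrder b d k → IsOrder b d l → k ≡ l
IsOrder-unique {k = k} {l} (0<k , bᵏ≡1 , kmin) (0<l , bˡ≡1 , lmin) =
  ≤-antisym (kmin l 0<l bˡ≡1) (lmin k 0<k bᵏ≡1)

-- The existential over k expresses O_d(b) = O_N(b), both sides being defined.
Overpseudoprime : ℕ → ℕ → Set
Overpseudoprime b N =
  Composite N ×
  Coprime N b ×
  (∀ d → 1 < d → d ∣ N → ∃[ k ] IsOrder b d k × IsOrder b N k)

Primover : ℕ → ℕ → Set
Primover b N = 1 < N × Coprime N b × (Prime N ⊎ Overpseudoprime b N)

{-# OPTIONS --safe #-}

-- If a divisor f > 1 of R divides 3^j - 1, then 2^n divides j: otherwise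
-- gcd(j, p 2^n) divides p 2^(n-1), and f divides both 3^(p 2^(n-1)) - 1 and,
-- by hypothesis, 3^(p 2^(n-1)) + 1, hence the odd number f divides 2.  By Fermat,
-- every prime q ∣ R thus satisfies 2^n ∣ q - 1.  If also p ∣ q - 1, then q = R,
-- which is composite; so gcd(q - 1, p 2^n) divides 2^n and q divides
-- z = 3^(2^n) - 1.  Now R divides (1 + z)^p - 1 = z (p + z w), and no prime
-- factor of R divides p + z w, since it divides z but not p.  So R ∣ z, and
-- every divisor f > 1 of R has order exactly 2^n.
module Submission where

open import Data.Integer.Base using (+_; -1ℤ; 1ℤ)
open import Data.Nat using (ℕ; zero; suc; _+_; _*_; _∸_; _^_; _/_; _<_; _≤_; z<s; s<s; NonZero; >-nonZero; n>1⇒nonTrivial; nonTrivial⇒n>1)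
open import Data.Nat.Combinatorics using (_C_; nCn≡1; nC1≡n; nCk+nC[k+1]≡[n+1]C[k+1])
open import Data.Nat.Coprimality as Coprime using (Coprime; coprime-divisor)
open import Data.Nat.Divisibility
open import Data.Nat.DivMod using (m*n/n≡m)
open import Data.Nat.GCD using (gcd; gcd[m,n]∣m; gcd[m,n]∣n; gcd-GCD; module Bézout)
open import Data.Nat.ListAction using (product)
open import Data.Nat.Primality
open import Data.Nat.Primality.Factorisation using (PrimeFactorisation; factorise)
open import Data.Nat.Properties
open import Data.Nat.Tactic.RingSolver using (solve-∀)
open import Data.Fin.Base using (Fin; zero; suc; toℕ; fromℕ; inject₁)
open import Data.Fin.Properties using (toℕ<n; toℕ-fromℕ; toℕ-inject₁)
open import Data.List.Base using (_∷_; [])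
open import Data.List.Relation.Unary.All using (All; _∷_; [])
open import Data.Product using (_×_; _,_; ∃-syntax)
open import Data.Sum using (_⊎_; inj₁; inj₂)
open import Algebra.Properties.CommutativeSemiring.Binomial +-*-commutativeSemiring
  using (binomialTerm; theorem)
open import Algebra.Properties.Semiring.Sum +-*-semiring using (sum; sum-init-last)
open import Algebra.Properties.Semiring.Exp +-*-semiring using () renaming (_^_ to _^ˢ_)
open import Algebra.Properties.Semiring.Mult +-*-semiring using () renaming (_×_ to _×ˢ_)
open import Function.Base using (_∘_)
open import Relation.Nullary using (yes; no; contradiction)
open import Relation.Binary.PropositionalEquality using (_≡_; refl; sym; trans; cong; cong₂; subst; module ≡-Reasoning)
open import Defs

-- Fermat's little theorem

-- The absorption identity, kept free of division and proved by induction through Pascal's rule.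
[k+1]*[n+1]C[k+1]≡[n+1]*nCk : ∀ n k → suc k * (suc n C suc k) ≡ suc n * (n C k)
[k+1]*[n+1]C[k+1]≡[n+1]*nCk zero    zero    = refl
[k+1]*[n+1]C[k+1]≡[n+1]*nCk zero    (suc k) = *-zeroʳ k
[k+1]*[n+1]C[k+1]≡[n+1]*nCk (suc n) zero    =
  trans (*-identityˡ _) (trans (nC1≡n (suc (suc n))) (sym (*-identityʳ _)))
[k+1]*[n+1]C[k+1]≡[n+1]*nCk (suc n) (suc k) = begin
  suc (suc k) * (suc (suc n) C suc (suc k))
    ≡⟨ cong (suc (suc k) *_) (sym (nCk+nC[k+1]≡[n+1]C[k+1] (suc n) (suc k))) ⟩
  suc (suc k) * (c + suc n C suc (suc k))
    ≡⟨ *-distribˡ-+ (suc (suc k)) c _ ⟩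
  (c + suc k * c) + suc (suc k) * (suc n C suc (suc k))
    ≡⟨ cong₂ (λ u v → (c + u) + v) ([k+1]*[n+1]C[k+1]≡[n+1]*nCk n k) ([k+1]*[n+1]C[k+1]≡[n+1]*nCk n (suc k)) ⟩
  (c + suc n * (n C k)) + suc n * (n C suc k)
    ≡⟨ +-assoc c _ _ ⟩
  c + (suc n * (n C k) + suc n * (n C suc k))
    ≡⟨ cong (_+_ c) (sym (*-distribˡ-+ (suc n) (n C k) (n C suc k))) ⟩
  c + suc n * (n C k + n C suc k)
    ≡⟨ cong (λ u → c + suc n * u) (nCk+nC[k+1]≡[n+1]C[k+1] n k) ⟩
  suc (suc n) * c ∎
  where
  open ≡-Reasoning
  c = suc n C suc k

-- By absorption `q` divides `k * (q C k)`, and it cannot divide `k`, which lies strictly between 0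
-- and `q`.
prime∣binomial : ∀ {q k} → Prime q → 0 < k → k < q → q ∣ q C k
prime∣binomial {suc n} {suc k} pq _ k<q
  with euclidsLemma (suc k) (suc n C suc k) pq
         (subst (suc n ∣_) (sym ([k+1]*[n+1]C[k+1]≡[n+1]*nCk n k)) (m∣m*n (n C k)))
... | inj₁ q∣k = contradiction q∣k (>⇒∤ k<q)
... | inj₂ q∣C = q∣C

-- The binomial theorem is available for the generic multiples and powers of a semiring; this and
-- `^ˢ≡^` identify them with the operations of `ℕ`.
×ˢ≡* : ∀ m n → m ×ˢ n ≡ m * n
×ˢ≡* zero    n = refl
×ˢ≡* (suc m) n = cong (_+_ n) (×ˢ≡* m n)

^ˢ≡^ : ∀ m n → m ^ˢ n ≡ m ^ n
^ˢ≡^ m zero    = refl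
^ˢ≡^ m (suc n) = cong (_*_ m) (^ˢ≡^ m n)

∣sum : ∀ {d n} (t : Fin n → ℕ) → (∀ i → d ∣ t i) → d ∣ sum t
∣sum {d} {zero}  t d∣t = d ∣0
∣sum {d} {suc n} t d∣t = ∣m∣n⇒∣m+n (d∣t zero) (∣sum (t ∘ suc) (d∣t ∘ suc))

binomialTerm≡ : ∀ a n k → binomialTerm a 1 n k ≡ (n C toℕ k) * a ^ toℕ k
binomialTerm≡ a n k = trans (×ˢ≡* (n C toℕ k) _) (cong ((n C toℕ k) *_) (begin
  a ^ˢ toℕ k * 1 ^ˢ (n ∸ toℕ k) ≡⟨ cong₂ _*_ (^ˢ≡^ a (toℕ k)) (trans (^ˢ≡^ 1 (n ∸ toℕ k)) (^-zeroˡ (n ∸ toℕ k))) ⟩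
  a ^ toℕ k * 1                 ≡⟨ *-identityʳ _ ⟩
  a ^ toℕ k                     ∎))
  where open ≡-Reasoning

freshman : ∀ {q} → Prime q → ∀ a → ∃[ s ] (suc a ^ q ≡ 1 + (q * s + a ^ q))
freshman {zero}      pq a = contradiction pq ¬prime[0]
freshman {q@(suc m)} pq a with ∣sum middle q∣middle
  where
  middle : Fin m → ℕ
  middle i = binomialTerm a 1 q (suc (inject₁ i))
  q∣middle : ∀ i → q ∣ middle i
  q∣middle i = subst (q ∣_) (sym (binomialTerm≡ a q (suc (inject₁ i))))
    (∣m⇒∣m*n _ (prime∣binomial pq z<s (s<s (subst (_< m) (sym (toℕ-inject₁ i)) (toℕ<n i)))))
... | divides s eq = s , (begin
  suc a ^ q                                    ≡⟨ cong (_^ q) (+-comm 1 a) ⟩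
  (a + 1) ^ q                                  ≡⟨ sym (^ˢ≡^ (a + 1) q) ⟩
  (a + 1) ^ˢ q                                 ≡⟨ theorem q a 1 ⟩
  t zero + sum (t ∘ suc)                       ≡⟨ cong (_+ sum (t ∘ suc)) (binomialTerm≡ a q zero) ⟩
  -- With the last term split off as well, what remains is the sum of `middle`, all of whose terms
  -- are multiples of `q`.
  1 + sum (t ∘ suc)                            ≡⟨ cong suc (sum-init-last (t ∘ suc)) ⟩
  1 + (sum (t ∘ suc ∘ inject₁) + t (fromℕ q))  ≡⟨ cong₂ (λ u v → 1 + (u + v)) (trans eq (*-comm s q)) last≡ ⟩
  1 + (q * s + a ^ q)                          ∎)
  where
  open ≡-Reasoning
  t = binomialTerm a 1 q
  last≡ : t (fromℕ q) ≡ a ^ q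
  last≡ = begin
    t (fromℕ q)                              ≡⟨ binomialTerm≡ a q (fromℕ q) ⟩
    (q C toℕ (fromℕ q)) * a ^ toℕ (fromℕ q)  ≡⟨ cong (λ k → (q C k) * a ^ k) (toℕ-fromℕ q) ⟩
    (q C q) * a ^ q                          ≡⟨ cong (_* a ^ q) (nCn≡1 q) ⟩
    1 * a ^ q                                ≡⟨ *-identityˡ _ ⟩
    a ^ q                                    ∎

-- Writing the congruence additively keeps subtraction out of the induction on `a`, whose step is
-- `freshman`.
fermat : ∀ {q} → Prime q → ∀ a → ∃[ c ] (a ^ q ≡ a + q * c)
fermat {zero}      pq a    = contradiction pq ¬prime[0]
fermat {q@(suc _)} pq zero = 0 , sym (*-zeroʳ q)
fermat {q}         pq (suc a) with freshman pq a | fermat pq a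
... | s , eq | c , ih = s + c , trans eq (cong suc (begin
  q * s + a ^ q       ≡⟨ cong (_+_ (q * s)) ih ⟩
  q * s + (a + q * c) ≡⟨ regroup q s a c ⟩
  a + q * (s + c)     ∎))
  where
  open ≡-Reasoning
  regroup : ∀ q s a c → q * s + (a + q * c) ≡ a + q * (s + c)
  regroup = solve-∀

fermat-coprime : ∀ {q a} → Prime q → Coprime q a → q ∣ a ^ (q ∸ 1) ∸ 1
fermat-coprime {zero}      pq cop = contradiction pq ¬prime[0]
fermat-coprime {q@(suc m)} {a} pq cop with fermat pq a
... | c , eq = coprime-divisor cop (divides c (begin
  a * (a ^ m ∸ 1)     ≡⟨ *-distribˡ-∸ a (a ^ m) 1 ⟩
  a * a ^ m ∸ a * 1   ≡⟨ cong₂ _∸_ eq (*-identityʳ a) ⟩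
  a + q * c ∸ a       ≡⟨ m+n∸m≡n a (q * c) ⟩
  q * c               ≡⟨ *-comm q c ⟩
  c * q               ∎))
  where open ≡-Reasoning

-- Coprimality

prime∤⇒coprime : ∀ {p m} → Prime p → p ∤ m → Coprime p m
prime∤⇒coprime pp p∤m (d∣p , d∣m) with prime⇒irreducible pp d∣p
... | inj₁ d≡1  = d≡1
... | inj₂ refl = contradiction d∣m p∤m

coprime-^ʳ : ∀ {m b} n → Coprime m b → Coprime m (b ^ n)
coprime-^ʳ zero    cop (_ , d∣1) = ∣1⇒≡1 d∣1
coprime-^ʳ (suc n) cop (d∣m , d∣bⁿ⁺¹) =
  coprime-^ʳ n cop (d∣m , coprime-divisor (λ (e∣d , e∣b) → cop (∣-trans e∣d d∣m , e∣b)) d∣bⁿ⁺¹)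

∣1+n⇒coprime : ∀ {m n} → m ∣ n + 1 → Coprime m n
∣1+n⇒coprime m∣n+1 (d∣m , d∣n) = ∣1⇒≡1 (∣m+n∣m⇒∣n (∣-trans d∣m m∣n+1) d∣n)

noCommonPrime⇒coprime : ∀ {m n} .{{_ : NonZero m}} →
  (∀ {q} → Prime q → q ∣ m → q ∤ n) → Coprime m n
noCommonPrime⇒coprime {m} none {zero} (d∣m , _) with 0∣⇒≡0 d∣m
noCommonPrime⇒coprime {{()}} none {zero} _ | refl
noCommonPrime⇒coprime none {d@(suc _)} (d∣m , d∣n) with factorise d
... | record { factors = []     ; isFactorisation = eq } = eq
... | record { factors = q ∷ qs ; isFactorisation = eq ; factorsPrime = pq ∷ _ } =
  contradiction (∣-trans q∣d d∣n) (none pq (∣-trans q∣d d∣m))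
  where q∣d = subst (q ∣_) (sym eq) (m∣m*n (product qs))

-- Factors 2 of `g` are cancelled one at a time against those of `2 ^ suc n`. If `g` runs out of
-- them first, one factor 2 on the right is to spare.
∣m*2ⁿ⁺¹⇒2ⁿ⁺¹∣⊎∣m*2ⁿ : ∀ n {g m} → g ∣ m * 2 ^ suc n → 2 ^ suc n ∣ g ⊎ g ∣ m * 2 ^ n
∣m*2ⁿ⁺¹⇒2ⁿ⁺¹∣⊎∣m*2ⁿ n {g} {m} g∣ with 2 ∣? g
... | no 2∤g = inj₂ (coprime-divisor (Coprime.sym (prime∤⇒coprime prime[2] 2∤g))
                       (subst (g ∣_) (double m (2 ^ n)) g∣))
  where
  double : ∀ m x → m * (2 * x) ≡ 2 * (m * x)
  double = solve-∀
∣m*2ⁿ⁺¹⇒2ⁿ⁺¹∣⊎∣m*2ⁿ zero    g∣ | yes 2∣g = inj₁ 2∣g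
∣m*2ⁿ⁺¹⇒2ⁿ⁺¹∣⊎∣m*2ⁿ (suc n) {m = m} g∣ | yes (divides h refl)
  with ∣m*2ⁿ⁺¹⇒2ⁿ⁺¹∣⊎∣m*2ⁿ n {h} {m} (*-cancelʳ-∣ 2 (subst (h * 2 ∣_) (halve m (2 ^ suc n)) g∣))
  where
  halve : ∀ m x → m * (2 * x) ≡ m * x * 2
  halve = solve-∀
... | inj₁ 2ⁿ∣h = inj₁ (subst (_∣ h * 2) (*-comm (2 ^ suc n) 2) (*-monoˡ-∣ 2 2ⁿ∣h))
... | inj₂ h∣   = inj₂ (subst (h * 2 ∣_) (halve m (2 ^ n)) (*-monoˡ-∣ 2 h∣))
  where
  halve : ∀ m x → m * x * 2 ≡ m * (2 * x)
  halve = solve-∀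

-- Exponents k with m ∣ b ^ k ∸ 1

module _ (b : ℕ) .{{_ : NonZero b}} where

  -- As `b` is nonzero, its powers are at least 1 and every truncated subtraction here is exact.
  ^-+-∸1 : ∀ d e → b ^ (d + e) ∸ 1 ≡ b ^ d * (b ^ e ∸ 1) + (b ^ d ∸ 1)
  ^-+-∸1 d e = sym (begin
    b ^ d * (b ^ e ∸ 1) + (b ^ d ∸ 1)         ≡⟨ sym (+-∸-assoc (b ^ d * (b ^ e ∸ 1)) (m^n>0 b d)) ⟩
    b ^ d * (b ^ e ∸ 1) + b ^ d ∸ 1           ≡⟨ cong (λ u → u + b ^ d ∸ 1) (*-distribˡ-∸ (b ^ d) (b ^ e) 1) ⟩
    b ^ d * b ^ e ∸ b ^ d * 1 + b ^ d ∸ 1     ≡⟨ cong (λ u → b ^ d * b ^ e ∸ u + b ^ d ∸ 1) (*-identityʳ (b ^ d)) ⟩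
    b ^ d * b ^ e ∸ b ^ d + b ^ d ∸ 1         ≡⟨ cong (_∸ 1) (m∸n+n≡m (m≤m*n (b ^ d) (b ^ e) {{m^n≢0 b e}})) ⟩
    b ^ d * b ^ e ∸ 1                         ≡⟨ cong (_∸ 1) (sym (^-distribˡ-+-* b d e)) ⟩
    b ^ (d + e) ∸ 1                           ∎)
    where open ≡-Reasoning

  ∣^∸1-mult : ∀ {m} j {k} → j ∣ k → m ∣ b ^ j ∸ 1 → m ∣ b ^ k ∸ 1
  ∣^∸1-mult {m} j (divides c refl) m∣ = go c
    where
    go : ∀ c → m ∣ b ^ (c * j) ∸ 1
    go zero    = m ∣0
    go (suc c) = subst (m ∣_) (sym (^-+-∸1 j (c * j))) (∣m∣n⇒∣m+n (∣n⇒∣m*n (b ^ j) (go c)) m∣)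

  ∣^∸1-gcd : ∀ {m} j k → m ∣ b ^ j ∸ 1 → m ∣ b ^ k ∸ 1 → m ∣ b ^ gcd j k ∸ 1
  ∣^∸1-gcd {m} j k m∣j m∣k with Bézout.identity (gcd-GCD j k)
  -- Here `gcd j k + y * k` equals `x * j`; expanding the power at this sum leaves `b ^ gcd j k ∸ 1`
  -- once a multiple of `b ^ (y * k) ∸ 1` is removed.
  ... | Bézout.+- x y eq = ∣m+n∣m⇒∣n
    (subst (m ∣_) (trans (cong (λ u → b ^ u ∸ 1) (sym eq)) (^-+-∸1 (gcd j k) (y * k))) (∣^∸1-mult j (n∣m*n x) m∣j))
    (∣n⇒∣m*n (b ^ gcd j k) (∣^∸1-mult k (n∣m*n y) m∣k))
  ... | Bézout.-+ x y eq = ∣m+n∣m⇒∣n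
    (subst (m ∣_) (trans (cong (λ u → b ^ u ∸ 1) (sym eq)) (^-+-∸1 (gcd j k) (x * j))) (∣^∸1-mult k (n∣m*n y) m∣k))
    (∣n⇒∣m*n (b ^ gcd j k) (∣^∸1-mult j (n∣m*n x) m∣j))

  ∣^+1⇒∣^2*∸1 : ∀ {m} e → m ∣ b ^ e + 1 → m ∣ b ^ (2 * e) ∸ 1
  ∣^+1⇒∣^2*∸1 {m} e m∣ = subst (m ∣_) (sym eq) (∣m⇒∣m*n (b ^ e ∸ 1) m∣)
    where
    open ≡-Reasoning
    factor : ∀ x y → x * y + y ≡ (x + 1) * y
    factor = solve-∀
    eq : b ^ (2 * e) ∸ 1 ≡ (b ^ e + 1) * (b ^ e ∸ 1)
    eq = begin
      b ^ (2 * e) ∸ 1                    ≡⟨ cong (λ u → b ^ (e + u) ∸ 1) (+-identityʳ e) ⟩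
      b ^ (e + e) ∸ 1                    ≡⟨ ^-+-∸1 e e ⟩
      b ^ e * (b ^ e ∸ 1) + (b ^ e ∸ 1)  ≡⟨ factor (b ^ e) (b ^ e ∸ 1) ⟩
      (b ^ e + 1) * (b ^ e ∸ 1)          ∎

  ∣^+1⇒∣^2ⁿ⁺¹∸1 : ∀ {f} p n → f ∣ b ^ (p * 2 ^ n) + 1 → f ∣ b ^ (p * 2 ^ suc n) ∸ 1
  ∣^+1⇒∣^2ⁿ⁺¹∸1 {f} p n f∣ =
    subst (λ u → f ∣ b ^ u ∸ 1) (double p (2 ^ n)) (∣^+1⇒∣^2*∸1 (p * 2 ^ n) f∣)
    where
    double : ∀ p x → 2 * (p * x) ≡ p * (2 * x)
    double = solve-∀

  ∣^∸1⇒2ⁿ⁺¹∣ : ∀ {f j} p n → f ∤ 2 → f ∣ b ^ (p * 2 ^ n) + 1 → f ∣ b ^ j ∸ 1 → 2 ^ suc n ∣ j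
  ∣^∸1⇒2ⁿ⁺¹∣ {f} {j} p n f∤2 f∣+1 f∣j
    with ∣m*2ⁿ⁺¹⇒2ⁿ⁺¹∣⊎∣m*2ⁿ n {m = p} (gcd[m,n]∣n j (p * 2 ^ suc n))
  ... | inj₁ 2ⁿ⁺¹∣g = ∣-trans 2ⁿ⁺¹∣g (gcd[m,n]∣m j _)
  -- The gcd lowers the exponent to `p * 2 ^ n`, so `f` divides both `x ∸ 1` and `x + 1`, which
  -- differ by 2.
  ... | inj₂ g∣ = contradiction (∣m+n∣m⇒∣n (subst (f ∣_) x+1≡ f∣+1) f∣∸1) f∤2
    where
    x = b ^ (p * 2 ^ n)
    f∣∸1 : f ∣ x ∸ 1
    f∣∸1 = ∣^∸1-mult _ g∣ (∣^∸1-gcd j (p * 2 ^ suc n) f∣j (∣^+1⇒∣^2ⁿ⁺¹∸1 p n f∣+1))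
    x+1≡ : x + 1 ≡ x ∸ 1 + 2
    x+1≡ = trans (cong (_+ 1) (sym (m∸n+n≡m (m^n>0 b (p * 2 ^ n))))) (+-assoc (x ∸ 1) 1 1)

-- From prime factors to the whole number

∣∸1-* : ∀ {d} m n → d ∣ m ∸ 1 → d ∣ n ∸ 1 → d ∣ m * n ∸ 1
∣∸1-* {d} zero    n       d∣m d∣n = d ∣0
∣∸1-* {d} (suc m) zero    d∣m d∣n = subst (λ u → d ∣ u ∸ 1) (sym (*-zeroʳ m)) (d ∣0)
∣∸1-* {d} (suc m) (suc n) d∣m d∣n = ∣m∣n⇒∣m+n d∣n (∣m⇒∣m*n (suc n) d∣m)

primes∣∸1⇒∣∸1 : ∀ {d m} .{{_ : NonZero m}} → (∀ {q} → Prime q → q ∣ m → d ∣ q ∸ 1) → d ∣ m ∸ 1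
primes∣∸1⇒∣∸1 {d} {m} d∣q∸1 = subst (λ u → d ∣ u ∸ 1) (sym isFactorisation)
  (go factors factorsPrime (∣-reflexive (sym isFactorisation)))
  where
  open PrimeFactorisation (factorise m)
  -- The partial product is carried along as a divisor of `m`, so that the hypothesis applies to
  -- each prime in it.
  go : ∀ qs → All Prime qs → product qs ∣ m → d ∣ product qs ∸ 1
  go []       []         _ = d ∣0
  go (q ∷ qs) (pq ∷ pqs) Π∣m =
    ∣∸1-* q (product qs) (d∣q∸1 pq (m*n∣⇒m∣ q (product qs) Π∣m)) (go qs pqs (m*n∣⇒n∣ q (product qs) Π∣m))

-- The binomial expansion up to its linear term; `w` collects the terms of degree at least 2,
-- divided by the square of `z`.
[1+z]^p≡1+z*[p+z*w] : ∀ z p → ∃[ w ] (suc z ^ p ≡ 1 + z * (p + z * w))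
[1+z]^p≡1+z*[p+z*w] z zero = 0 , base z
  where
  base : ∀ z → 1 ≡ 1 + z * (0 + z * 0)
  base = solve-∀
[1+z]^p≡1+z*[p+z*w] z (suc p) with [1+z]^p≡1+z*[p+z*w] z p
... | w , eq = w + p + z * w , trans (cong (suc z *_) eq) (step z p w)
  where
  step : ∀ z p w → (1 + z) * (1 + z * (p + z * w)) ≡ 1 + z * ((1 + p) + z * (w + p + z * w))
  step = solve-∀

-- If every prime factor of m divides b ^ k ∸ 1 but not p, then the cofactor
-- (b ^ (k * p) ∸ 1) / (b ^ k ∸ 1) ≡ p (mod b ^ k ∸ 1) is coprime to m.
∣^*∸1⇒∣^∸1 : ∀ b .{{_ : NonZero b}} {m} .{{_ : NonZero m}} k p → Coprime m p →
  (∀ {q} → Prime q → q ∣ m → q ∣ b ^ k ∸ 1) → m ∣ b ^ (k * p) ∸ 1 → m ∣ b ^ k ∸ 1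
∣^*∸1⇒∣^∸1 b {m} k p cop rad m∣ with [1+z]^p≡1+z*[p+z*w] (b ^ k ∸ 1) p
... | w , eq = coprime-divisor
      (noCommonPrime⇒coprime {m} {p + z * w} (λ {q} pq q∣m q∣p+zw →
        ¬prime[1] (subst Prime (cop (q∣m , ∣m+n∣m⇒∣n (subst (q ∣_) (+-comm p (z * w)) q∣p+zw)
                                            (∣m⇒∣m*n w (rad pq q∣m)))) pq)))
      (subst (m ∣_) ^∸1≡ m∣)
  where
  open ≡-Reasoning
  z = b ^ k ∸ 1
  ^∸1≡ : b ^ (k * p) ∸ 1 ≡ (p + z * w) * z
  ^∸1≡ = begin
    b ^ (k * p) ∸ 1          ≡⟨ cong (_∸ 1) (sym (^-*-assoc b k p)) ⟩
    (b ^ k) ^ p ∸ 1          ≡⟨ cong (λ u → u ^ p ∸ 1) (sym (m+[n∸m]≡n (m^n>0 b k))) ⟩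
    suc z ^ p ∸ 1            ≡⟨ cong (_∸ 1) eq ⟩
    z * (p + z * w)          ≡⟨ *-comm z (p + z * w) ⟩
    (p + z * w) * z          ∎

-- Once `x` is a successor, the integer difference computes to its predecessor, so both sides are
-- the same divisibility.
≡1⇒∣∸1 : ∀ {x m} → 0 < x → + x ≡ 1ℤ [mod m ] → m ∣ x ∸ 1
≡1⇒∣∸1 {suc x} {m} _ m∣ = m∣

∣∸1⇒≡1 : ∀ {x m} → 0 < x → m ∣ x ∸ 1 → + x ≡ 1ℤ [mod m ]
∣∸1⇒≡1 {suc x} _ m∣ = m∣

-- Divisors of `R`

module _ (p n : ℕ) (pp : Prime p) (2<p : 2 < p) (cR : Composite (p * 2 ^ suc n + 1))
         (b : ℕ) .{{_ : NonZero b}} (R∣ : p * 2 ^ suc n + 1 ∣ b ^ (p * 2 ^ n) + 1) where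

  private
    -- The exponent of 2 is a successor, so that half of `R ∸ 1` is `p * 2 ^ n` without a division.
    R : ℕ
    R = p * 2 ^ suc n + 1

  private instance
    R≢0 : NonZero R
    R≢0 = composite⇒nonZero cR

  ∣R⇒∤2 : ∀ {f} → 1 < f → f ∣ R → f ∤ 2
  ∣R⇒∤2 1<f f∣R f∣2 = <⇒≢ 1<f (sym (∣1+n⇒coprime f∣R (∣-refl , ∣n⇒∣m*n p (∣m⇒∣m*n (2 ^ n) f∣2))))

  -- The exponent `p * 2 ^ n` is positive, so a common divisor of `f` and `b` divides both that
  -- power of `b` and its successor.
  ∣R⇒coprime : ∀ {f} → f ∣ R → Coprime f b
  ∣R⇒coprime f∣R (d∣f , d∣b) =
    ∣1+n⇒coprime (∣-trans f∣R R∣) (d∣f , ∣-trans d∣b (b∣b^ (m*n≢0 p (2 ^ n) {{prime⇒nonZero pp}} {{m^n≢0 2 n}})))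
    where
    b∣b^ : ∀ {e} → NonZero e → b ∣ b ^ e
    b∣b^ {suc e} _ = m∣m*n (b ^ e)

  ∣^∸1⇒2ⁿ⁺¹∣′ : ∀ {f j} → 1 < f → f ∣ R → f ∣ b ^ j ∸ 1 → 2 ^ suc n ∣ j
  ∣^∸1⇒2ⁿ⁺¹∣′ 1<f f∣R = ∣^∸1⇒2ⁿ⁺¹∣ b p n (∣R⇒∤2 1<f f∣R) (∣-trans f∣R R∣)

  prime∣R⇒2ⁿ⁺¹∣∸1 : ∀ {q} → Prime q → q ∣ R → 2 ^ suc n ∣ q ∸ 1
  prime∣R⇒2ⁿ⁺¹∣∸1 pq q∣R =
    ∣^∸1⇒2ⁿ⁺¹∣′ (nonTrivial⇒n>1 _ {{prime⇒nonTrivial pq}}) q∣R (fermat-coprime pq (∣R⇒coprime q∣R))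

  prime∣R⇒p∤∸1 : ∀ {q} → Prime q → q ∣ R → p ∤ q ∸ 1
  prime∣R⇒p∤∸1 {q} pq q∣R p∣q∸1 with prime∣R⇒2ⁿ⁺¹∣∸1 pq q∣R
  ... | divides c q∸1≡ = composite⇒¬prime cR (subst Prime (≤-antisym (∣⇒≤ q∣R) R≤q) pq)
    where
    1<q = nonTrivial⇒n>1 q {{prime⇒nonTrivial pq}}
    p∣c : p ∣ c
    -- Being an odd prime, `p` is coprime to `2 ^ suc n` and must divide the cofactor `c`; hence
    -- `R ∸ 1` divides `q ∸ 1`.
    p∣c = coprime-divisor (coprime-^ʳ (suc n) (prime∤⇒coprime pp (>⇒∤ 2<p)))
            (subst (p ∣_) (trans q∸1≡ (*-comm c (2 ^ suc n))) p∣q∸1)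
    R≤q : R ≤ q
    R≤q = subst (R ≤_) (m∸n+n≡m (<⇒≤ 1<q)) (+-monoˡ-≤ 1
      (∣⇒≤ {{>-nonZero (m<n⇒0<n∸m 1<q)}} (subst (p * 2 ^ suc n ∣_) (sym q∸1≡) (*-monoˡ-∣ (2 ^ suc n) p∣c))))

  prime∣R⇒∣^2ⁿ⁺¹∸1 : ∀ {q} → Prime q → q ∣ R → q ∣ b ^ (2 ^ suc n) ∸ 1
  prime∣R⇒∣^2ⁿ⁺¹∸1 {q} pq q∣R = ∣^∸1-mult b g g∣2ⁿ⁺¹
    (∣^∸1-gcd b (q ∸ 1) (p * 2 ^ suc n) (fermat-coprime pq (∣R⇒coprime q∣R)) (∣^+1⇒∣^2ⁿ⁺¹∸1 b p n (∣-trans q∣R R∣)))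
    where
    g = gcd (q ∸ 1) (p * 2 ^ suc n)
    g∣2ⁿ⁺¹ : g ∣ 2 ^ suc n
    -- Since `p` does not divide `q ∸ 1`, it does not divide `g` and cancels from
    -- `g ∣ p * 2 ^ suc n`.
    g∣2ⁿ⁺¹ = coprime-divisor
      (Coprime.sym (prime∤⇒coprime pp (λ p∣g → prime∣R⇒p∤∸1 pq q∣R (∣-trans p∣g (gcd[m,n]∣m (q ∸ 1) _)))))
      (gcd[m,n]∣n (q ∸ 1) (p * 2 ^ suc n))

  R∣^2ⁿ⁺¹∸1 : R ∣ b ^ (2 ^ suc n) ∸ 1
  R∣^2ⁿ⁺¹∸1 = ∣^*∸1⇒∣^∸1 b (2 ^ suc n) p
    (λ (d∣R , d∣p) → ∣1+n⇒coprime d∣R (∣-refl , ∣m⇒∣m*n (2 ^ suc n) d∣p))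
    prime∣R⇒∣^2ⁿ⁺¹∸1
    (subst (λ u → R ∣ b ^ u ∸ 1) (*-comm p (2 ^ suc n)) (∣^+1⇒∣^2ⁿ⁺¹∸1 b p n R∣))

  ∣R⇒order : ∀ {f} → 1 < f → f ∣ R → IsOrder b f (2 ^ suc n)
  ∣R⇒order 1<f f∣R =
    m^n>0 2 (suc n) ,
    ∣∸1⇒≡1 (m^n>0 b (2 ^ suc n)) (∣-trans f∣R R∣^2ⁿ⁺¹∸1) ,
    -- Minimality: any such `j` is a positive multiple of `2 ^ suc n`.
    λ j 0<j bʲ≡1 → ∣⇒≤ {{>-nonZero 0<j}} (∣^∸1⇒2ⁿ⁺¹∣′ 1<f f∣R (≡1⇒∣∸1 (m^n>0 b j) bʲ≡1))

  ∣R⇒primover : ∀ {f} → 1 < f → f ∣ R → Primover b f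
  ∣R⇒primover {f} 1<f f∣R = 1<f , ∣R⇒coprime f∣R , primeOrOverpseudoprime
    where
    primeOrOverpseudoprime : Prime f ⊎ Overpseudoprime b f
    primeOrOverpseudoprime with prime? f
    ... | yes pf = inj₁ pf
    ... | no ¬pf = inj₂
      ( ¬prime⇒composite {{n>1⇒nonTrivial 1<f}} ¬pf
      , ∣R⇒coprime f∣R
      -- Both `d` and `f` divide `R`, so they share the order `2 ^ suc n`.
      , λ d 1<d d∣f → 2 ^ suc n , ∣R⇒order 1<d (∣-trans d∣f f∣R) , ∣R⇒order 1<f f∣R)

  ∣R⇒≡k*2ⁿ⁺¹+1 : ∀ {f} → 1 < f → f ∣ R → ∃[ k ] (0 < k × f ≡ k * 2 ^ suc n + 1)
  ∣R⇒≡k*2ⁿ⁺¹+1 {f} 1<f f∣R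
    with primes∣∸1⇒∣∸1 {m = f} {{>-nonZero (<⇒≤ 1<f)}} (λ pq q∣f → prime∣R⇒2ⁿ⁺¹∣∸1 pq (∣-trans q∣f f∣R))
  ... | divides zero    f∸1≡ = contradiction f∸1≡ (>⇒≢ (m<n⇒0<n∸m 1<f))
  ... | divides (suc k) f∸1≡ = suc k , z<s , trans (sym (m∸n+n≡m (<⇒≤ 1<f))) (cong (_+ 1) f∸1≡)

mainTheorem3 : (p n R : ℕ) → Prime p → 3 < p → 2 < n →
    R ≡ p * 2 ^ n + 1 →
    Composite R →
    + (3 ^ ((R ∸ 1) / 2)) ≡ -1ℤ [mod R ] →
    (f : ℕ) → 1 < f → f ∣ R →
    (∃[ k ] (0 < k × f ≡ k * 2 ^ n + 1)) × Primover 3 f × IsOrder 3 f (2 ^ n)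
mainTheorem3 p (suc n) R pp 3<p _ refl cR 3^≡-1 f 1<f f∣R =
  ∣R⇒≡k*2ⁿ⁺¹+1 p n pp 2<p cR 3 R∣ 1<f f∣R ,
  ∣R⇒primover p n pp 2<p cR 3 R∣ 1<f f∣R ,
  ∣R⇒order p n pp 2<p cR 3 R∣ 1<f f∣R
  where
  open ≡-Reasoning
  2<p = <-trans (n<1+n 2) 3<p
  halve : ∀ p x → p * (2 * x) ≡ p * x * 2
  halve = solve-∀
  [R∸1]/2≡ : (R ∸ 1) / 2 ≡ p * 2 ^ n
  [R∸1]/2≡ = begin
    (R ∸ 1) / 2              ≡⟨ cong (_/ 2) (m+n∸n≡m (p * 2 ^ suc n) 1) ⟩
    p * 2 ^ suc n / 2        ≡⟨ cong (_/ 2) (halve p (2 ^ n)) ⟩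
    p * 2 ^ n * 2 / 2        ≡⟨ m*n/n≡m (p * 2 ^ n) 2 ⟩
    p * 2 ^ n                ∎
  R∣ : R ∣ 3 ^ (p * 2 ^ n) + 1
  -- Subtracting `-1ℤ` computes to adding 1, so the assumed congruence is already a divisibility of
  -- this shape.
  R∣ = subst (λ e → R ∣ 3 ^ e + 1) [R∸1]/2≡ 3^≡-1
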